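{- There exists a lattice game on the board $\mathbb{N}^3$ with normal play (that is, with no defeated positions, $\mathcal D=\emptyset$) which has no rational strategy: its set $\mathcal P$ of $\mathrm{P}$-positions does not have a rational generating function $\sum_{p\in\mathcal P}x^p\in\mathbb{Z}[[x_1,x_2,x_3]]$.
   Context: A lattice game on $\mathbb{N}^3$ is specified by (1) a finite set $\mathcal D\subseteq\mathbb{N}^3$ of defeated positions such that the board $\mathcal B:=\mathbb{N}^3\setminus\mathcal D$ satisfies $\mathcal B+\mathbb{N}^3\subseteq\mathcal B$; and (2) a ruleset $\Gamma\subseteq\mathbb{Z}^3$, a finite set satisfying: (i) (pointedness) there is a linear functional $\varphi:\mathbb{R}^3\to\mathbb{R}$ with $\varphi(\gamma)>0$ for all $\gamma\in\Gamma$ and $\varphi(e_i)>0$ for $i=1,2,3$; (ii) (tangent cone axiom) for each ray $\rho=\mathbb{R}_{\ge0}e_i$ of $\mathbb{R}^3_{\ge0}$ there is $\gamma\in\Gamma$ with $-\gamma\in\mathbb{R}^3_{\ge0}+\mathbb{R}e_i$ (i.e. $\gamma_j\le0$ for all $j\ne i$). The positions are the elements of $\mathcal B$; the options of $p\in\mathcal B$ are the points $p-\gamma$ with $\gamma\in\Gamma$ and $p-\gamma\in\mathcal B$. Outcomes are defined by induction on $\varphi$: $p$ is a $\mathrm{P}$-position if none of its options is a $\mathrm{P}$-position, and an $\mathrm{N}$-position otherwise. Normal play means $\mathcal D=\emptyset$. The game has a rational strategy if the generating function $\sum_{p\in\mathcal P}x^p$ of its set $\mathcal P$ of $\mathrm{P}$-positions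 is a rational function of $x_1,x_2,x_3$ (equivalently, $\mathcal P$ is a finite disjoint union of intersections of rational polyhedra with translates of sublattices of $\mathbb{Z}^3$). -}

module Defs where

open import Data.Bool.Base using (if_then_else_)
open import Data.Fin.Base using (Fin; zero; suc)
open import Data.Integer as ℤ using (ℤ; +_; 0ℤ; 1ℤ)
import Data.Integer.Properties as ℤ
open import Data.Integer.Tactic.RingSolver using (solve-∀)
open import Data.List.Base using (List; []; _∷_; foldr; map; upTo)
open import Data.List.Membership.Propositional using (_∈_; _∉_)
import Data.List.Membership.DecPropositional as DecMembership
open import Data.List.Relation.Unary.Any using (here; there)
open import Data.Nat.Base as ℕ using (ℕ; _∸_)
import Data.Nat.Properties as ℕ
open import Data.Nat.Induction using (<-wellFounded)
open import Data.Product using (Σ-syntax; ∃-syntax; _×_; _,_; proj₁; proj₂)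
open import Data.Rational as ℚ using (ℚ; 0ℚ)
import Data.Rational.Properties as ℚ
open import Data.Rational.Unnormalised as ℚᵘ using (ℚᵘ; 0ℚᵘ)
import Data.Rational.Unnormalised.Properties as ℚᵘ
open import Data.Vec.Base as Vec using (Vec; []; _∷_; lookup; replicate; zipWith; _[_]≔_)
open import Data.Vec.Properties using (≡-dec)
open import Function.Base using (_∘_)
open import Function.Bundles using (_⇔_; mk⇔)
open import Induction.WellFounded using (Acc; acc; WellFounded)
import Induction.WellFounded as WF
import Relation.Binary.Construct.On as On
open import Relation.Binary.PropositionalEquality
  using (_≡_; _≢_; refl; sym; trans; cong; cong₂; subst; subst₂)
open import Relation.Nullary using (Dec; yes; no; does; ¬_; ¬?)

------------------------------------------------------------------------
-- Lattice points

ℕ³ ℤ³ : Set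
ℕ³ = Vec ℕ 3
ℤ³ = Vec ℤ 3

_+³_ : ℕ³ → ℕ³ → ℕ³
_+³_ = zipWith ℕ._+_

_-³_ : ℤ³ → ℤ³ → ℤ³
_-³_ = zipWith ℤ._-_

ι : ℕ³ → ℤ³
ι = Vec.map (+_)

e : Fin 3 → ℕ³
e i = replicate 3 0 [ i ]≔ 1

-- A linear functional is given by its coefficients.  Rational
-- coefficients lose no generality for pointedness: it asks for a solution
-- of finitely many strict linear inequalities with integer coefficients,
-- and the open set of real solutions contains a rational point as soon as
-- it is nonempty.

LinearFunctional : Set
LinearFunctional = Vec ℚ 3

_⟨_⟩ : LinearFunctional → ℤ³ → ℚ
(a ∷ b ∷ c ∷ []) ⟨ x ∷ y ∷ z ∷ [] ⟩ =
  a ℚ.* (x ℚ./ 1) ℚ.+ b ℚ.* (y ℚ./ 1) ℚ.+ c ℚ.* (z ℚ./ 1)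

------------------------------------------------------------------------
-- Lattice games

-- Finite sets are given by lists; repeated entries are irrelevant.

record LatticeGame : Set where
  field
    defeated : List ℕ³
    ruleset  : List ℤ³

  OnBoard : ℕ³ → Set
  OnBoard p = p ∉ defeated

  field
    board-closed : ∀ p v → OnBoard p → OnBoard (p +³ v)

    pointed : Σ[ φ ∈ LinearFunctional ]
                (∀ γ → γ ∈ ruleset → 0ℚ ℚ.< φ ⟨ γ ⟩) ×
                (∀ i → 0ℚ ℚ.< φ ⟨ ι (e i) ⟩)

    -- γ_j ≤ 0 for all j ≠ i says that - γ lies in the tangent cone
    -- ℝ³≥0 + ℝ e_i of the orthant along the ray of e_i.
    tangent-cone : ∀ i → ∃[ γ ] γ ∈ ruleset ×
                     (∀ j → j ≢ i → lookup γ j ℤ.≤ 0ℤ)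

  -- q ◁ p : q is an option of p.
  _◁_ : ℕ³ → ℕ³ → Set
  q ◁ p = OnBoard q × (∃[ γ ] γ ∈ ruleset × ι q ≡ ι p -³ γ)

NormalPlay : LatticeGame → Set
NormalPlay G = ∀ p → p ∉ LatticeGame.defeated G

------------------------------------------------------------------------
-- The option relation is well-founded

private
  -- φ(v) times a positive common denominator of the coefficients of φ.
  numer : LinearFunctional → ℤ³ → ℤ
  numer (a ∷ b ∷ c ∷ []) (x ∷ y ∷ z ∷ []) =
    (ℚ.↥ a ℤ.* x) ℤ.* (ℚ.↧ b ℤ.* ℚ.↧ c) ℤ.+
    (ℚ.↥ b ℤ.* y) ℤ.* (ℚ.↧ a ℤ.* ℚ.↧ c) ℤ.+
    (ℚ.↥ c ℤ.* z) ℤ.* (ℚ.↧ a ℤ.* ℚ.↧ b)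

  termᵘ : ℚ → ℤ → ℚᵘ
  termᵘ a x = ℚ.toℚᵘ a ℚᵘ.* ℚᵘ.mkℚᵘ x 0

  /1ᵘ : ∀ x → ℚ.toℚᵘ (x ℚ./ 1) ℚᵘ.≃ ℚᵘ.mkℚᵘ x 0
  /1ᵘ x = ℚ.toℚᵘ-fromℚᵘ (ℚᵘ.mkℚᵘ x 0)

  term≃ : ∀ a x → ℚ.toℚᵘ (a ℚ.* (x ℚ./ 1)) ℚᵘ.≃ termᵘ a x
  term≃ a x = ℚᵘ.≃-trans (ℚ.toℚᵘ-homo-* a (x ℚ./ 1))
                         (ℚᵘ.*-congˡ {ℚ.toℚᵘ a} (/1ᵘ x))

  sum≃ : ∀ a b c x y z →
         ℚ.toℚᵘ ((a ∷ b ∷ c ∷ []) ⟨ x ∷ y ∷ z ∷ [] ⟩) ℚᵘ.≃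
         (termᵘ a x ℚᵘ.+ termᵘ b y ℚᵘ.+ termᵘ c z)
  sum≃ a b c x y z =
    ℚᵘ.≃-trans (ℚ.toℚᵘ-homo-+ (a ℚ.* (x ℚ./ 1) ℚ.+ b ℚ.* (y ℚ./ 1)) (c ℚ.* (z ℚ./ 1)))
      (ℚᵘ.+-cong
        (ℚᵘ.≃-trans (ℚ.toℚᵘ-homo-+ (a ℚ.* (x ℚ./ 1)) (b ℚ.* (y ℚ./ 1)))
          (ℚᵘ.+-cong (term≃ a x) (term≃ b y)))
        (term≃ c z))

  positive-numerator : ∀ q → 0ℚᵘ ℚᵘ.< q → 0ℤ ℤ.< ℚᵘ.↥ q
  positive-numerator q (ℚᵘ.*<* lt) =
    subst₂ ℤ._<_ (ℤ.*-zeroˡ (ℚᵘ.↧ q)) (ℤ.*-identityʳ (ℚᵘ.↥ q)) lt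

  rearrange : ∀ a b c x y z u v w →
    ((a ℤ.* x) ℤ.* v ℤ.+ (b ℤ.* y) ℤ.* u) ℤ.* w ℤ.+ (c ℤ.* z) ℤ.* (u ℤ.* v) ≡
    (a ℤ.* x) ℤ.* (v ℤ.* w) ℤ.+ (b ℤ.* y) ℤ.* (u ℤ.* w) ℤ.+ (c ℤ.* z) ℤ.* (u ℤ.* v)
  rearrange = solve-∀

  numer-pos : ∀ φ v → 0ℚ ℚ.< φ ⟨ v ⟩ → 0ℤ ℤ.< numer φ v
  numer-pos (a@record{} ∷ b@record{} ∷ c@record{} ∷ []) (x ∷ y ∷ z ∷ []) φv>0 =
    subst (0ℤ ℤ.<_) eq
      (positive-numerator s (ℚᵘ.<-respʳ-≃ (sum≃ a b c x y z) (ℚ.toℚᵘ-mono-< φv>0)))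
    where
    s : ℚᵘ
    s = termᵘ a x ℚᵘ.+ termᵘ b y ℚᵘ.+ termᵘ c z

    den : ∀ d x → ℚᵘ.↧ (termᵘ d x) ≡ ℚ.↧ d
    den record{} x = cong +_ (ℕ.*-identityʳ _)

    den₂ : ℚᵘ.↧ (termᵘ a x ℚᵘ.+ termᵘ b y) ≡ ℚ.↧ a ℤ.* ℚ.↧ b
    den₂ = trans (ℤ.pos-* (ℚᵘ.↧ₙ (termᵘ a x)) (ℚᵘ.↧ₙ (termᵘ b y)))
                 (cong₂ ℤ._*_ (den a x) (den b y))

    eq : ℚᵘ.↥ s ≡ numer (a ∷ b ∷ c ∷ []) (x ∷ y ∷ z ∷ [])
    eq = trans
      (cong₂ ℤ._+_
        (cong₂ ℤ._*_
          (cong₂ ℤ._+_ (cong ((ℚ.↥ a ℤ.* x) ℤ.*_) (den b y))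
                       (cong ((ℚ.↥ b ℤ.* y) ℤ.*_) (den a x)))
          (den c z))
        (cong ((ℚ.↥ c ℤ.* z) ℤ.*_) den₂))
      (rearrange (ℚ.↥ a) (ℚ.↥ b) (ℚ.↥ c) x y z (ℚ.↧ a) (ℚ.↧ b) (ℚ.↧ c))

  numer-minus : ∀ φ v w → numer φ (v -³ w) ≡ numer φ v ℤ.- numer φ w
  numer-minus (a ∷ b ∷ c ∷ []) (x ∷ y ∷ z ∷ []) (x′ ∷ y′ ∷ z′ ∷ []) =
    lemma (ℚ.↥ a) (ℚ.↥ b) (ℚ.↥ c) x y z x′ y′ z′ (ℚ.↧ a) (ℚ.↧ b) (ℚ.↧ c)
    where
    lemma : ∀ a b c x y z x′ y′ z′ u v w →
      (a ℤ.* (x ℤ.- x′)) ℤ.* (v ℤ.* w) ℤ.+ (b ℤ.* (y ℤ.- y′)) ℤ.* (u ℤ.* w)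
        ℤ.+ (c ℤ.* (z ℤ.- z′)) ℤ.* (u ℤ.* v) ≡
      ((a ℤ.* x) ℤ.* (v ℤ.* w) ℤ.+ (b ℤ.* y) ℤ.* (u ℤ.* w) ℤ.+ (c ℤ.* z) ℤ.* (u ℤ.* v))
      ℤ.-
      ((a ℤ.* x′) ℤ.* (v ℤ.* w) ℤ.+ (b ℤ.* y′) ℤ.* (u ℤ.* w) ℤ.+ (c ℤ.* z′) ℤ.* (u ℤ.* v))
    lemma = solve-∀

  numer-basis : ∀ φ x y z → numer φ (x ∷ y ∷ z ∷ []) ≡
    x ℤ.* numer φ (ι (e zero)) ℤ.+ y ℤ.* numer φ (ι (e (suc zero)))
      ℤ.+ z ℤ.* numer φ (ι (e (suc (suc zero))))
  numer-basis (a ∷ b ∷ c ∷ []) x y z =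
    lemma (ℚ.↥ a) (ℚ.↥ b) (ℚ.↥ c) x y z (ℚ.↧ a) (ℚ.↧ b) (ℚ.↧ c)
    where
    lemma : ∀ a b c x y z u v w →
      (a ℤ.* x) ℤ.* (v ℤ.* w) ℤ.+ (b ℤ.* y) ℤ.* (u ℤ.* w) ℤ.+ (c ℤ.* z) ℤ.* (u ℤ.* v) ≡
      x ℤ.* ((a ℤ.* 1ℤ) ℤ.* (v ℤ.* w) ℤ.+ (b ℤ.* 0ℤ) ℤ.* (u ℤ.* w) ℤ.+ (c ℤ.* 0ℤ) ℤ.* (u ℤ.* v))
      ℤ.+
      y ℤ.* ((a ℤ.* 0ℤ) ℤ.* (v ℤ.* w) ℤ.+ (b ℤ.* 1ℤ) ℤ.* (u ℤ.* w) ℤ.+ (c ℤ.* 0ℤ) ℤ.* (u ℤ.* v))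
      ℤ.+
      z ℤ.* ((a ℤ.* 0ℤ) ℤ.* (v ℤ.* w) ℤ.+ (b ℤ.* 0ℤ) ℤ.* (u ℤ.* w) ℤ.+ (c ℤ.* 1ℤ) ℤ.* (u ℤ.* v))
    lemma = solve-∀

  pos*nonneg : ∀ n i → 0ℤ ℤ.≤ i → 0ℤ ℤ.≤ + n ℤ.* i
  pos*nonneg n (+ m) _ = subst (0ℤ ℤ.≤_) (ℤ.pos-* n m) (ℤ.+≤+ ℕ.z≤n)

  numer-nonneg : ∀ φ → (∀ i → 0ℚ ℚ.< φ ⟨ ι (e i) ⟩) → ∀ p → 0ℤ ℤ.≤ numer φ (ι p)
  numer-nonneg φ φ>0 (x ∷ y ∷ z ∷ []) =
    subst (0ℤ ℤ.≤_) (sym (numer-basis φ (+ x) (+ y) (+ z)))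
      (ℤ.+-mono-≤ (ℤ.+-mono-≤ (bit x zero) (bit y (suc zero))) (bit z (suc (suc zero))))
    where
    bit : ∀ n i → 0ℤ ℤ.≤ + n ℤ.* numer φ (ι (e i))
    bit n i = pos*nonneg n _ (ℤ.<⇒≤ (numer-pos φ (ι (e i)) (φ>0 i)))

  ∣∣-mono-< : ∀ {i j} → 0ℤ ℤ.≤ i → i ℤ.< j → ℤ.∣ i ∣ ℕ.< ℤ.∣ j ∣
  ∣∣-mono-< {+ _} _ (ℤ.+<+ m<n) = m<n

module _ (G : LatticeGame) where
  open LatticeGame G

  private
    φ = proj₁ pointed

    measure : ℕ³ → ℕ
    measure p = ℤ.∣ numer φ (ι p) ∣

    measure-◁ : ∀ {q p} → q ◁ p → measure q ℕ.< measure p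
    measure-◁ {q} {p} (_ , γ , γ∈Γ , q≡p-γ) =
      ∣∣-mono-< (numer-nonneg φ (proj₂ (proj₂ pointed)) q)
        (subst (ℤ._< numer φ (ι p))
          (sym (trans (cong (numer φ) q≡p-γ) (numer-minus φ (ι p) γ)))
          (subst (numer φ (ι p) ℤ.- numer φ γ ℤ.<_) (ℤ.+-identityʳ _)
            (ℤ.+-monoʳ-< (numer φ (ι p))
              (ℤ.neg-mono-< (numer-pos φ γ (proj₁ (proj₂ pointed) γ γ∈Γ))))))

  ◁-wellFounded : WellFounded _◁_
  ◁-wellFounded =
    WF.Subrelation.wellFounded measure-◁ (On.wellFounded measure <-wellFounded)

------------------------------------------------------------------------
-- Outcomes

  private
    IsPAcc : ∀ p → Acc _◁_ p → Set
    IsPAcc p (acc rs) = OnBoard p × (∀ q (o : q ◁ p) → ¬ IsPAcc q (rs o))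

  -- The set of P-positions, by well-founded recursion along options.
  IsP : ℕ³ → Set
  IsP p = IsPAcc p (◁-wellFounded p)

  IsN : ℕ³ → Set
  IsN p = OnBoard p × ¬ IsP p

  private
    irrelevant : ∀ {p} (a a′ : Acc _◁_ p) → IsPAcc p a → IsPAcc p a′
    irrelevant (acc rs) (acc rs′) (b , h) =
      b , λ q o isP → h q o (irrelevant (rs′ o) (rs o) isP)

  IsP-unfold : ∀ p → IsP p ⇔ (OnBoard p × (∀ q → q ◁ p → ¬ IsP q))
  IsP-unfold p with ◁-wellFounded p
  ... | acc rs = mk⇔
    (λ (b , h) → b , λ q o isP → h q o (irrelevant _ _ isP))
    (λ (b , h) → b , λ q o isP → h q o (irrelevant _ _ isP))

  private
    ι-injective : ∀ {p q} → ι p ≡ ι q → p ≡ q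
    ι-injective {_ ∷ _ ∷ _ ∷ []} {_ ∷ _ ∷ _ ∷ []} refl = refl

    ι-image? : ∀ v → Dec (∃[ q ] ι q ≡ v)
    ι-image? (+ x ∷ + y ∷ + z ∷ []) = yes ((x ∷ y ∷ z ∷ []) , refl)
    ι-image? (ℤ.-[1+ _ ] ∷ _ ∷ _ ∷ []) = no λ { (_ ∷ _ ∷ _ ∷ [] , ()) }
    ι-image? (+ _ ∷ ℤ.-[1+ _ ] ∷ _ ∷ []) = no λ { (_ ∷ _ ∷ _ ∷ [] , ()) }
    ι-image? (+ _ ∷ + _ ∷ ℤ.-[1+ _ ] ∷ []) = no λ { (_ ∷ _ ∷ _ ∷ [] , ()) }

    OnBoard? : ∀ p → Dec (OnBoard p)
    OnBoard? p = ¬? (p ∈? defeated)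
      where open DecMembership (≡-dec {n = 3} ℕ._≟_) using (_∈?_)

    any∈? : ∀ {Q : ℤ³ → Set} γs → (∀ γ → γ ∈ γs → Dec (Q γ)) →
            Dec (∃[ γ ] γ ∈ γs × Q γ)
    any∈? []       Q? = no λ ()
    any∈? (γ ∷ γs) Q? with Q? γ (here refl) | any∈? γs (λ γ′ → Q? γ′ ∘ there)
    ... | yes Qγ | _                  = yes (γ , here refl , Qγ)
    ... | no _   | yes (γ′ , ∈γs , Qγ′) = yes (γ′ , there ∈γs , Qγ′)
    ... | no ¬Qγ | no ¬Qγs            = no λ where
      (_ , here refl , Qγ)  → ¬Qγ Qγ
      (γ′ , there ∈γs , Qγ′) → ¬Qγs (γ′ , ∈γs , Qγ′)

    isPAcc? : ∀ p (a : Acc _◁_ p) → Dec (IsPAcc p a)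
    isPAcc? p (acc rs) with OnBoard? p
    ... | no ¬b = no (¬b ∘ proj₁)
    ... | yes b with any∈? ruleset P-option-via?
      where
      P-option-via? : ∀ γ → γ ∈ ruleset →
        Dec (∃[ q ] OnBoard q × ι q ≡ ι p -³ γ × IsP q)
      P-option-via? γ γ∈Γ with ι-image? (ι p -³ γ)
      ... | no ¬im = no λ (q , _ , eq , _) → ¬im (q , eq)
      ... | yes (q , eq) with OnBoard? q
      ...   | no ¬bq = no λ (q′ , bq′ , eq′ , _) →
        ¬bq (subst OnBoard (ι-injective (trans eq′ (sym eq))) bq′)
      ...   | yes bq with isPAcc? q (rs (bq , γ , γ∈Γ , eq))
      ...     | yes isP = yes (q , bq , eq , irrelevant _ _ isP)
      ...     | no ¬isP = no λ (q′ , _ , eq′ , isP′) →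
        ¬isP (irrelevant _ _ (subst IsP (ι-injective (trans eq′ (sym eq))) isP′))
    ...   | yes (γ , γ∈Γ , q , bq , eq , isP) =
      no λ (_ , h) → h q (bq , γ , γ∈Γ , eq) (irrelevant _ _ isP)
    ...   | no ¬∃ = yes (b , λ q (bq , γ , γ∈Γ , eq) isP →
      ¬∃ (γ , γ∈Γ , q , bq , eq , irrelevant _ _ isP))

  IsP? : ∀ p → Dec (IsP p)
  IsP? p = isPAcc? p (◁-wellFounded p)

------------------------------------------------------------------------
-- Generating functions

-- A formal power series in ℤ[[x₁,x₂,x₃]], as its coefficient function.
PowerSeries : Set
PowerSeries = ℕ³ → ℤ

sum≤ : ℕ → (ℕ → ℤ) → ℤ
sum≤ n f = foldr ℤ._+_ 0ℤ (map f (upTo (ℕ.suc n)))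

infixl 7 _⊛_

_⊛_ : PowerSeries → PowerSeries → PowerSeries
(f ⊛ g) (x ∷ y ∷ z ∷ []) =
  sum≤ x λ a → sum≤ y λ b → sum≤ z λ c →
    f (a ∷ b ∷ c ∷ []) ℤ.* g (x ∸ a ∷ y ∸ b ∷ z ∸ c ∷ [])

IsPolynomial : PowerSeries → Set
IsPolynomial f = ∃[ N ] (∀ p → (∃[ i ] N ℕ.≤ lookup p i) → f p ≡ 0ℤ)

-- f is a quotient A / B of polynomials: B f = A with B ≠ 0.  B may have
-- zero constant term.  Integer coefficients suffice, since every element
-- of ℚ(x₁,x₂,x₃) is a quotient of integer polynomials.
IsRational : PowerSeries → Set
IsRational f = ∃[ A ] ∃[ B ] IsPolynomial A × IsPolynomial B ×
  (∃[ p ] B p ≢ 0ℤ) × (∀ p → (B ⊛ f) p ≡ A p)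

generatingFunction : LatticeGame → PowerSeries
generatingFunction G p = if does (IsP? G p) then 1ℤ else 0ℤ

HasRationalStrategy : LatticeGame → Set
HasRationalStrategy G = IsRational (generatingFunction G)

{-# OPTIONS --safe #-}

-- Every move lowers z by 0 or 1, so the outcomes in the layer z = 0 are those of
-- a planar game, and they turn out to be periodic modulo (4 , 5).  The moves
-- lowering z by 1 then make every position of the layer z = 1 an N-position,
-- except in four residue classes.  On these an outcome is the NOR of two of the
-- outcomes nearby, and together they form the four-gate NOR circuit for XNOR, so
-- that the layer z = 1 computes the binomial coefficients modulo 2.
--
-- For a power of two t, Pascal's triangle modulo 2 has period t in the first t
-- columns, but not in the next one.  Hence shifting the P-positions by 5t in the
-- y-direction changes nothing up to some point s in a lexicographic order and
-- does change s, where the y-coordinate of s is unbounded as t grows.  If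
-- B f = A with polynomials A and B, then comparing the equation at s + b and at
-- its shift, for the lexicographically first b with B b ≢ 0, gives B b ≡ 0.
module Submission where

open import Defs
open import Data.Product using (Σ-syntax; _×_)
open import Relation.Nullary using (¬_)

import Data.Integer.Properties as ℤ
open import Algebra.Properties.AbelianGroup ℤ.+-0-abelianGroup using (∙-cancelˡ; ∙-cancelʳ)
open import Data.Bool.Base using (Bool; true; false; not; _∧_; _∨_; _xor_; T; if_then_else_)
open import Data.Bool.ListAction using (any)
open import Data.Bool.Properties
  using (T-≡; ∧-zeroʳ; ∨-assoc; ∨-identityʳ; ∨-zeroʳ; xor-assoc; xor-comm; xor-same)
open import Data.Fin.Base using (zero; suc)
import Data.Fin.Properties as Fin
open import Data.Integer as ℤ using (ℤ; +_; -[1+_]; 0ℤ; 1ℤ; _⊖_; -_; _%ℕ_; _/ℕ_)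
open import Data.Integer.DivMod using (a≡a%ℕn+[a/ℕn]*n)
open import Data.List.Base using (List; []; _∷_; _++_; applyUpTo; filter; foldr; map)
import Data.List.Membership.DecPropositional as DecMembership
open import Data.List.Membership.Propositional using (_∈_; find; lose)
open import Data.List.Membership.Propositional.Properties using (∈-++⁺ˡ; ∈-map⁺)
open import Data.List.Properties using (map-upTo)
open import Data.List.Relation.Unary.All as All using (All; []; _∷_)
open import Data.List.Relation.Unary.Any as Any using (Any; here; there)
open import Data.List.Relation.Unary.Any.Properties using (any⁺; any⁻)
open import Data.Nat.Base
  using (ℕ; zero; suc; _+_; _*_; _∸_; _≤_; _<_; NonZero; z≤n; s≤s; s≤s⁻¹; z<s; s<s)
open import Data.Nat.DivMod
open import Data.Nat.Induction using (<-rec)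
open import Data.Nat.Properties
open import Data.Product using (∃-syntax; _,_; proj₂)
open import Data.Product.Properties using (≡-dec)
open import Data.Rational as ℚ using (0ℚ; 1ℚ)
import Data.Rational.Properties as ℚ
open import Data.Sum.Base using (_⊎_; inj₁; inj₂)
open import Data.Vec.Base using ([]; _∷_; lookup)
open import Function.Base using (_∘_)
open import Function.Bundles using (Equivalence)
open import Induction.WellFounded using (Acc; acc)
open import Relation.Binary.Definitions using (tri<; tri≈; tri>)
open import Relation.Binary.PropositionalEquality
  using (_≡_; _≢_; refl; sym; trans; cong; cong₂; subst; subst₂; module ≡-Reasoning)
open import Relation.Nullary using (Dec; yes; no; does; ¬?; contradiction)
open import Relation.Nullary.Decidable using (dec-true; dec-false; from-yes; _→-dec_; _×-dec_)

-- Power series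

-- `applyUpTo` peels off `f 0` and leaves a sum of the same form, which suits induction on `n`; the
-- tail of `upTo` is no longer an `upTo`.
sum< : ℕ → (ℕ → ℤ) → ℤ
sum< n f = foldr ℤ._+_ 0ℤ (applyUpTo f n)

sum≤≡sum< : ∀ n f → sum≤ n f ≡ sum< (suc n) f
sum≤≡sum< n f = cong (foldr ℤ._+_ 0ℤ) (map-upTo f (suc n))

sum<-cong : ∀ n {f g : ℕ → ℤ} → (∀ i → i < n → f i ≡ g i) → sum< n f ≡ sum< n g
sum<-cong zero    f≡g = refl
sum<-cong (suc n) f≡g =
  cong₂ ℤ._+_ (f≡g 0 z<s) (sum<-cong n λ i i<n → f≡g (suc i) (s<s i<n))

sum<-zero : ∀ n {f : ℕ → ℤ} → (∀ i → f i ≡ 0ℤ) → sum< n f ≡ 0ℤ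
sum<-zero zero    f≡0 = refl
sum<-zero (suc n) f≡0 = cong₂ ℤ._+_ (f≡0 0) (sum<-zero n λ i → f≡0 (suc i))

sum<-truncate : ∀ {m n} {f : ℕ → ℤ} → m ≤ n → (∀ i → m ≤ i → f i ≡ 0ℤ) →
                sum< n f ≡ sum< m f
sum<-truncate {n = n} z≤n f≡0 = sum<-zero n λ i → f≡0 i z≤n
sum<-truncate {f = f} (s≤s m≤n) f≡0 =
  cong (λ v → f 0 ℤ.+ v) (sum<-truncate m≤n λ i m≤i → f≡0 (suc i) (s≤s m≤i))

sum<-cancel : ∀ {k n} {f g : ℕ → ℤ} → k < n → (∀ i → i < n → i ≢ k → f i ≡ g i) →
              sum< n f ≡ sum< n g → f k ≡ g k
sum<-cancel {zero} {suc n} {f} {g} _ f≡g eq =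
  ∙-cancelʳ (sum< n λ i → f (suc i)) (f 0) (g 0)
    (trans eq (cong (λ v → g 0 ℤ.+ v)
      (sum<-cong n λ i i<n → sym (f≡g (suc i) (s<s i<n) λ ()))))
sum<-cancel {suc k} {suc n} {f} {g} (s<s k<n) f≡g eq =
  sum<-cancel k<n (λ i i<n i≢k → f≡g (suc i) (s<s i<n) λ { refl → i≢k refl })
    (∙-cancelˡ (f 0) _ _ (trans eq (cong (ℤ._+ _) (sym (f≡g 0 z<s λ ())))))

sum≤-cong : ∀ n {f g : ℕ → ℤ} → (∀ i → i ≤ n → f i ≡ g i) → sum≤ n f ≡ sum≤ n g
sum≤-cong n {f} {g} f≡g = begin
  sum≤ n f        ≡⟨ sum≤≡sum< n f ⟩
  sum< (suc n) f  ≡⟨ sum<-cong (suc n) (λ i i<n → f≡g i (s≤s⁻¹ i<n)) ⟩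
  sum< (suc n) g  ≡⟨ sum≤≡sum< n g ⟨
  sum≤ n g        ∎
  where open ≡-Reasoning

sum≤-zero : ∀ n {f : ℕ → ℤ} → (∀ i → f i ≡ 0ℤ) → sum≤ n f ≡ 0ℤ
sum≤-zero n {f} f≡0 = trans (sum≤≡sum< n f) (sum<-zero (suc n) f≡0)

sum≤-truncate : ∀ {m n} {f : ℕ → ℤ} → m ≤ n → (∀ i → m ≤ i → f i ≡ 0ℤ) →
                sum≤ n f ≡ sum≤ m f
sum≤-truncate {m} {n} {f} m≤n f≡0 = begin
  sum≤ n f        ≡⟨ sum≤≡sum< n f ⟩
  sum< (suc n) f  ≡⟨ sum<-truncate (s≤s m≤n) (λ i m<i → f≡0 i (<⇒≤ m<i)) ⟩
  sum< (suc m) f  ≡⟨ sum≤≡sum< m f ⟨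
  sum≤ m f        ∎
  where open ≡-Reasoning

sum≤-cancel : ∀ {k n} {f g : ℕ → ℤ} → k ≤ n → (∀ i → i ≤ n → i ≢ k → f i ≡ g i) →
              sum≤ n f ≡ sum≤ n g → f k ≡ g k
sum≤-cancel {k} {n} {f} {g} k≤n f≡g eq =
  sum<-cancel (s≤s k≤n) (λ i i<n → f≡g i (s≤s⁻¹ i<n))
    (trans (sym (sum≤≡sum< n f)) (trans eq (sum≤≡sum< n g)))

i≡0⇒i*j≡0 : ∀ {i j : ℤ} → i ≡ 0ℤ → i ℤ.* j ≡ 0ℤ
i≡0⇒i*j≡0 {j = j} refl = ℤ.*-zeroˡ j

shift₂ : ℕ → PowerSeries → PowerSeries
shift₂ t f (x ∷ y ∷ z ∷ []) = f (x ∷ y + t ∷ z ∷ [])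

-- Beyond the y-degree of `B`, the additional terms of the longer sum vanish, and in the others
-- subtracting `b` commutes with adding `t`.
⊛-shift₂ : ∀ {B f N} t → (∀ x y z → N ≤ y → B (x ∷ y ∷ z ∷ []) ≡ 0ℤ) →
           ∀ x y z → N ≤ y →
           (B ⊛ f) (x ∷ y + t ∷ z ∷ []) ≡ (B ⊛ shift₂ t f) (x ∷ y ∷ z ∷ [])
⊛-shift₂ {B} {f} {N} t B≡0 x y z N≤y =
  sum≤-cong x {λ a → sum≤ (y + t) (column a)}
    {λ a → sum≤ y (column′ a)} λ a _ →
  trans
    (sum≤-truncate {f = column a} (m≤m+n y t) λ b y≤b → sum≤-zero z λ c →
      i≡0⇒i*j≡0 {j = f (x ∸ a ∷ y + t ∸ b ∷ z ∸ c ∷ [])} (B≡0 a b c (≤-trans N≤y y≤b)))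
    (sum≤-cong y {column a} {column′ a} λ b b≤y → sum≤-cong z λ c _ →
      cong (λ v → B (a ∷ b ∷ c ∷ []) ℤ.* f (x ∸ a ∷ v ∷ z ∸ c ∷ [])) (+-∸-comm t b≤y))
  where
  column column′ : ℕ → ℕ → ℤ
  column a b = sum≤ z λ c → B (a ∷ b ∷ c ∷ []) ℤ.* f (x ∸ a ∷ y + t ∸ b ∷ z ∸ c ∷ [])
  column′ a b = sum≤ z λ c → B (a ∷ b ∷ c ∷ []) ℤ.* f (x ∸ a ∷ y ∸ b + t ∷ z ∸ c ∷ [])

-- The lexicographic order

infix 4 _≺_

-- The most significant coordinate is z, then x, then y: layers first, then the columns of a layer.
_≺_ : ℕ³ → ℕ³ → Set
(x ∷ y ∷ z ∷ []) ≺ (x′ ∷ y′ ∷ z′ ∷ []) =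
  z < z′ ⊎ z ≡ z′ × (x < x′ ⊎ x ≡ x′ × y < y′)

≺-rec : (P : ℕ³ → Set) → (∀ p → (∀ q → q ≺ p → P q) → P p) → ∀ p → P p
≺-rec P step (x ∷ y ∷ z ∷ []) =
  <-rec (λ z → ∀ x y → P (x ∷ y ∷ z ∷ []))
    (λ z ihz → λ x y → <-rec (λ x → ∀ y → P (x ∷ y ∷ z ∷ []))
      (λ x ihx → <-rec (λ y → P (x ∷ y ∷ z ∷ []))
        λ y ihy → step (x ∷ y ∷ z ∷ []) λ where
          (x′ ∷ y′ ∷ z′ ∷ []) (inj₁ z<)                        → ihz z< x′ y′
          (x′ ∷ y′ ∷ z′ ∷ []) (inj₂ (refl , inj₁ x<))          → ihx x< y′
          (x′ ∷ y′ ∷ z′ ∷ []) (inj₂ (refl , inj₂ (refl , y<))) → ihy y<)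
      x y)
    z x y

≺-split : ∀ p q → p ≡ q ⊎ (p ≺ q ⊎ q ≺ p)
≺-split (x ∷ y ∷ z ∷ []) (x′ ∷ y′ ∷ z′ ∷ []) with <-cmp z z′
... | tri< z< _ _ = inj₂ (inj₁ (inj₁ z<))
... | tri> _ _ z> = inj₂ (inj₂ (inj₁ z>))
... | tri≈ _ refl _ with <-cmp x x′
...   | tri< x< _ _ = inj₂ (inj₁ (inj₂ (refl , inj₁ x<)))
...   | tri> _ _ x> = inj₂ (inj₂ (inj₂ (refl , inj₁ x>)))
...   | tri≈ _ refl _ with <-cmp y y′
...     | tri< y< _ _    = inj₂ (inj₁ (inj₂ (refl , inj₂ (refl , y<))))
...     | tri≈ _ refl _ = inj₁ refl
...     | tri> _ _ y>    = inj₂ (inj₂ (inj₂ (refl , inj₂ (refl , y>))))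

-- Applied to coordinates of `s`, `b` and `c`: a coordinate of `c` exceeding that of `b` puts
-- `s + b - c` below `s` there.
m+n∸o<m : ∀ m {n o} → n < o → o ≤ m + n → m + n ∸ o < m
m+n∸o<m m {n} {o} n<o o≤m+n = +-cancelʳ-< o (m + n ∸ o) m
  (subst (_< m + o) (sym (m∸n+n≡m o≤m+n)) (+-monoʳ-< m n<o))

-- Breaks of periodicity and rationality

record BreaksAt (f : PowerSeries) (t : ℕ) (s : ℕ³) : Set where
  field
    before : ∀ p → p ≺ s → shift₂ t f p ≡ f p
    at     : shift₂ t f s ≢ f s

lookup₂-bound : ∀ {f} → IsPolynomial f →
                ∃[ N ] (∀ x y z → N ≤ y → f (x ∷ y ∷ z ∷ []) ≡ 0ℤ)
lookup₂-bound (N , f≡0) = N , λ x y z N≤y → f≡0 (x ∷ y ∷ z ∷ []) (suc zero , N≤y)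

module _ {f : PowerSeries}
  (breaks : ∀ N → ∃[ x ] ∃[ y ] ∃[ z ] ∃[ t ] N ≤ y × BreaksAt f t (x ∷ y ∷ z ∷ []))
  where

  -- One break `s` beyond the y-degrees of `A` and `B` serves every `b`. In the two products at
  -- `s + b`, terms with `c ≺ b` vanish by induction, and terms with `b ≺ c` evaluate the series at
  -- `s + b - c ≺ s`, where the shift changes nothing. Only the term of `b` could tell the products
  -- apart.
  annihilator-zero : ∀ {A B} → IsPolynomial A → IsPolynomial B →
                     (∀ p → (B ⊛ f) p ≡ A p) → ∀ b → B b ≡ 0ℤ
  annihilator-zero {A} {B} polyA polyB Bf≡A
    with M , A≡0 ← lookup₂-bound polyA | N , B≡0 ← lookup₂-bound polyB
    with sx , sy , sz , t , large , brk ← breaks (M + N) =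
    ≺-rec (λ b → B b ≡ 0ℤ) step
    where
    open BreaksAt brk

    M≤sy : M ≤ sy
    M≤sy = ≤-trans (m≤m+n M N) large
    N≤sy : N ≤ sy
    N≤sy = ≤-trans (m≤n+m N M) large

    step : ∀ b → (∀ c → c ≺ b → B c ≡ 0ℤ) → B b ≡ 0ℤ
    step b@(bx ∷ by ∷ bz ∷ []) B≡0-before with B b ℤ.≟ 0ℤ
    ... | yes Bb≡0 = Bb≡0
    ... | no  Bb≢0 = contradiction
      (ℤ.*-cancelˡ-≡ (B b) _ _ {{ℤ.≢-nonZero Bb≢0}} Bb*)
      (subst₂ (λ u v → u ≢ v) (cong (shift₂ t f) p∸b) (cong f p∸b) at)
      where
      px = sx + bx
      py = sy + by
      pz = sz + bz

      p∸b : (sx ∷ sy ∷ sz ∷ []) ≡ (px ∸ bx ∷ py ∸ by ∷ pz ∸ bz ∷ [])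
      p∸b = sym (cong₂ _∷_ (m+n∸n≡m sx bx)
                  (cong₂ _∷_ (m+n∸n≡m sy by) (cong₂ _∷_ (m+n∸n≡m sz bz) refl)))

      term : PowerSeries → ℕ → ℕ → ℕ → ℤ
      term g x y z = B (x ∷ y ∷ z ∷ []) ℤ.* g (px ∸ x ∷ py ∸ y ∷ pz ∸ z ∷ [])

      row : PowerSeries → ℕ → ℕ → ℤ
      row g x y = sum≤ pz (term g x y)

      M≤py : M ≤ py
      M≤py = ≤-trans M≤sy (m≤m+n sy by)

      -- Both sides are coefficients of `A` beyond its y-degree, hence zero.
      total : (B ⊛ shift₂ t f) (px ∷ py ∷ pz ∷ []) ≡ (B ⊛ f) (px ∷ py ∷ pz ∷ [])
      total = begin
        (B ⊛ shift₂ t f) (px ∷ py ∷ pz ∷ [])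
          ≡⟨ ⊛-shift₂ {B} {f} t B≡0 px py pz (≤-trans N≤sy (m≤m+n sy by)) ⟨
        (B ⊛ f) (px ∷ py + t ∷ pz ∷ [])
          ≡⟨ Bf≡A _ ⟩
        A (px ∷ py + t ∷ pz ∷ [])
          ≡⟨ A≡0 px (py + t) pz (≤-trans M≤py (m≤m+n py t)) ⟩
        0ℤ
          ≡⟨ A≡0 px py pz M≤py ⟨
        A (px ∷ py ∷ pz ∷ [])
          ≡⟨ Bf≡A _ ⟨
        (B ⊛ f) (px ∷ py ∷ pz ∷ [])
          ∎
        where open ≡-Reasoning

      other : ∀ x y z → x ≤ px → y ≤ py → z ≤ pz → (x ∷ y ∷ z ∷ []) ≢ b →
              term (shift₂ t f) x y z ≡ term f x y z
      other x y z x≤ y≤ z≤ ≢b with ≺-split (x ∷ y ∷ z ∷ []) b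
      ... | inj₁ ≡b = contradiction ≡b ≢b
      ... | inj₂ (inj₁ ≺b) = trans (vanish (shift₂ t f)) (sym (vanish f))
        where
        vanish : ∀ g → term g x y z ≡ 0ℤ
        vanish g = i≡0⇒i*j≡0 {j = g (px ∸ x ∷ py ∸ y ∷ pz ∸ z ∷ [])} (B≡0-before _ ≺b)
      ... | inj₂ (inj₂ b≺) = cong (B (x ∷ y ∷ z ∷ []) ℤ.*_) (before _ (earlier b≺))
        where
        earlier : b ≺ (x ∷ y ∷ z ∷ []) →
                  (px ∸ x ∷ py ∸ y ∷ pz ∸ z ∷ []) ≺ (sx ∷ sy ∷ sz ∷ [])
        earlier (inj₁ bz<z) = inj₁ (m+n∸o<m sz bz<z z≤)
        earlier (inj₂ (refl , inj₁ bx<x)) =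
          inj₂ (m+n∸n≡m sz bz , inj₁ (m+n∸o<m sx bx<x x≤))
        earlier (inj₂ (refl , inj₂ (refl , by<y))) =
          inj₂ (m+n∸n≡m sz bz , inj₂ (m+n∸n≡m sx bx , m+n∸o<m sy by<y y≤))

      Bb* : B b ℤ.* shift₂ t f (px ∸ bx ∷ py ∸ by ∷ pz ∸ bz ∷ []) ≡
            B b ℤ.* f (px ∸ bx ∷ py ∸ by ∷ pz ∸ bz ∷ [])
      -- To be read from the inside out: `total` is cut down to the slice at `bx`, then to the row
      -- at `by`, then to the single term at `bz`.
      Bb* = sum≤-cancel {f = term (shift₂ t f) bx by} {term f bx by} (m≤n+m bz sz)
        (λ z z≤ z≢ → other bx by z (m≤n+m bx sx) (m≤n+m by sy) z≤ λ { refl → z≢ refl })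
        (sum≤-cancel {f = row (shift₂ t f) bx} {row f bx} (m≤n+m by sy)
          (λ y y≤ y≢ → sum≤-cong pz {term (shift₂ t f) bx y} {term f bx y} λ z z≤ →
            other bx y z (m≤n+m bx sx) y≤ z≤ λ { refl → y≢ refl })
          (sum≤-cancel {f = λ x → sum≤ py (row (shift₂ t f) x)} {λ x → sum≤ py (row f x)}
            (m≤n+m bx sx)
            (λ x x≤ x≢ → sum≤-cong py {row (shift₂ t f) x} {row f x} λ y y≤ →
              sum≤-cong pz {term (shift₂ t f) x y} {term f x y} λ z z≤ →
              other x y z x≤ y≤ z≤ λ { refl → x≢ refl })
            total))

  ¬rational : ¬ IsRational f
  ¬rational (A , B , polyA , polyB , (b , Bb≢0) , Bf≡A) =
    Bb≢0 (annihilator-zero polyA polyB Bf≡A b)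

-- Binomial coefficients modulo 2

-- pascal i j is the parity of (i + j choose i).
pascal : ℕ → ℕ → Bool
pascal zero    j       = true
pascal (suc i) zero    = true
pascal (suc i) (suc j) = pascal i (suc j) xor pascal (suc i) j

pascal-zeroʳ : ∀ i → pascal i 0 ≡ true
pascal-zeroʳ zero    = refl
pascal-zeroʳ (suc i) = refl

pascal-sym : ∀ i j → pascal i j ≡ pascal j i
pascal-sym zero    j       = sym (pascal-zeroʳ j)
pascal-sym (suc i) zero    = refl
pascal-sym (suc i) (suc j) =
  trans (xor-comm (pascal i (suc j)) (pascal (suc i) j))
        (cong₂ _xor_ (pascal-sym (suc i) j) (pascal-sym i (suc j)))

xor-telescope : ∀ a b c → (a xor b) xor (b xor c) ≡ a xor c
xor-telescope false false c = refl
xor-telescope false true  false = refl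
xor-telescope false true  true = refl
xor-telescope true  false c = refl
xor-telescope true  true  c = refl

-- Pascal's rule with steps of length `t` instead of 1, and the period `t` in the second argument;
-- established below for powers of two.
record SelfSimilar (t : ℕ) : Set where
  field
    recurrence : ∀ i j → pascal (t + i) (t + j) ≡ pascal i (t + j) xor pascal (t + i) j
    periodic   : ∀ {i} → i < t → ∀ j → pascal i (t + j) ≡ pascal i j

selfSimilar-1 : SelfSimilar 1
selfSimilar-1 = record
  { recurrence = λ i j → refl
  ; periodic   = λ { z<s j → refl }
  }

-- Freshman's dream: squaring the operator identity 1 = X + Y modulo 2 gives 1 = X² + Y².
selfSimilar-double : ∀ {t} → SelfSimilar t → SelfSimilar (t + t)
selfSimilar-double {t} self = record { recurrence = recurrence₂ ; periodic = periodic₂ }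
  where
  open SelfSimilar self
  open ≡-Reasoning

  recurrence₂ : ∀ i j → pascal (t + t + i) (t + t + j) ≡
                pascal i (t + t + j) xor pascal (t + t + i) j
  recurrence₂ i j rewrite +-assoc t t i | +-assoc t t j = begin
    pascal (t + (t + i)) (t + (t + j))
      ≡⟨ recurrence (t + i) (t + j) ⟩
    pascal (t + i) (t + (t + j)) xor pascal (t + (t + i)) (t + j)
      ≡⟨ cong₂ _xor_ (recurrence i (t + j)) (recurrence (t + i) j) ⟩
    (pascal i (t + (t + j)) xor pascal (t + i) (t + j)) xor
      (pascal (t + i) (t + j) xor pascal (t + (t + i)) j)
      ≡⟨ xor-telescope (pascal i (t + (t + j))) _ _ ⟩
    pascal i (t + (t + j)) xor pascal (t + (t + i)) j
      ∎

  periodic₂ : ∀ {i} → i < t + t → ∀ j → pascal i (t + t + j) ≡ pascal i j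
  periodic₂ {i} i<2t j rewrite +-assoc t t j with <-≤-connex i t
  ... | inj₁ i<t = trans (periodic i<t (t + j)) (periodic i<t j)
  -- Two uses of the rule with step `t` produce `pascal i∸t (t + j)` twice, and the two copies
  -- cancel modulo 2.
  ... | inj₂ t≤i with i∸t , refl ← m≤n⇒∃[o]m+o≡n t≤i = begin
    pascal (t + i∸t) (t + (t + j))
      ≡⟨ recurrence i∸t (t + j) ⟩
    pascal i∸t (t + (t + j)) xor pascal (t + i∸t) (t + j)
      ≡⟨ cong₂ _xor_ (periodic i∸t<t (t + j)) (recurrence i∸t j) ⟩
    pascal i∸t (t + j) xor (pascal i∸t (t + j) xor pascal (t + i∸t) j)
      ≡⟨ xor-assoc (pascal i∸t (t + j)) _ _ ⟨
    (pascal i∸t (t + j) xor pascal i∸t (t + j)) xor pascal (t + i∸t) j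
      ≡⟨ cong (_xor pascal (t + i∸t) j) (xor-same (pascal i∸t (t + j))) ⟩
    pascal (t + i∸t) j
      ∎
    where
    i∸t<t : i∸t < t
    i∸t<t = +-cancelˡ-< t i∸t t i<2t

-- `suc t` runs through the powers of two, since `suc (t + suc t)` is `suc t + suc t` by definition.
selfSimilar-unbounded : ∀ n → ∃[ t ] n ≤ t × SelfSimilar (suc t)
selfSimilar-unbounded zero = 0 , z≤n , selfSimilar-1
selfSimilar-unbounded (suc n) with t , n≤t , self ← selfSimilar-unbounded n =
  t + suc t , ≤-trans (s≤s n≤t) (m≤n+m (suc t) t) , selfSimilar-double self

module _ {t} (self : SelfSimilar (suc t)) where
  open SelfSimilar self

  -- By symmetry this is periodicity of `pascal j`, carried back to its value at 0.
  edge-ones : ∀ {j} → j < suc t → pascal (suc t) j ≡ true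
  edge-ones {j} j<t = begin
    pascal (suc t) j        ≡⟨ pascal-sym (suc t) j ⟩
    pascal j (suc t)        ≡⟨ cong (pascal j) (+-identityʳ (suc t)) ⟨
    pascal j (suc t + 0)    ≡⟨ periodic j<t 0 ⟩
    pascal j 0              ≡⟨ pascal-zeroʳ j ⟩
    true                    ∎
    where open ≡-Reasoning

  -- `pascal (suc t)` is true at both `j` and `suc j`, so Pascal's rule forces the third entry to
  -- vanish.
  pascal-before-edge : ∀ {j} → j < t → pascal t (suc j) ≡ false
  pascal-before-edge {j} j<t =
    xor-true (trans (cong (pascal t (suc j) xor_) (sym (edge-ones (m<n⇒m<1+n j<t))))
                    (edge-ones (s<s j<t)))
    where
    xor-true : ∀ {a} → a xor true ≡ true → a ≡ false
    xor-true {false} _ = refl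

  pascal-corner : pascal t (suc t + suc t) ≡ true
  pascal-corner = begin
    pascal t (suc t + suc t)        ≡⟨ periodic (n<1+n t) (suc t) ⟩
    pascal t (suc t)                ≡⟨ pascal-sym t (suc t) ⟩
    pascal (suc t) t                ≡⟨ edge-ones (n<1+n t) ⟩
    true                            ∎
    where open ≡-Reasoning

  -- Here the period fails: the recurrence at `i = 0` negates the value `true` that `edge-ones`
  -- gives one period earlier.
  edge-zero : pascal (suc t) (suc t + t) ≡ false
  edge-zero = begin
    pascal (suc t) (suc t + t)                 ≡⟨ cong (λ v → pascal v (suc t + t)) (+-identityʳ (suc t)) ⟨
    pascal (suc t + 0) (suc t + t)             ≡⟨ recurrence 0 t ⟩
    not (pascal (suc t + 0) t)                 ≡⟨ cong (λ v → not (pascal v t)) (+-identityʳ (suc t)) ⟩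
    not (pascal (suc t) t)                     ≡⟨ cong not (edge-ones (n<1+n t)) ⟩
    false                                      ∎
    where open ≡-Reasoning

-- The game

-- The extension of `f` by `false`. Matching on z first lets a move to negative z compute to `false`
-- while x and y are still open terms.
onBoard : (ℕ³ → Bool) → ℤ³ → Bool
onBoard f (x ∷ y ∷ -[1+ _ ] ∷ []) = false
onBoard f (-[1+ _ ] ∷ y ∷ + z ∷ []) = false
onBoard f (+ x ∷ -[1+ _ ] ∷ + z ∷ []) = false
onBoard f (+ x ∷ + y ∷ + z ∷ []) = f (x ∷ y ∷ z ∷ [])

onBoard-ι : ∀ f q → onBoard f (ι q) ≡ f q
onBoard-ι f (x ∷ y ∷ z ∷ []) = refl

onBoard-true : ∀ f v → T (onBoard f v) → ∃[ q ] ι q ≡ v × T (f q)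
onBoard-true f (+ x ∷ + y ∷ + z ∷ []) fq = (x ∷ y ∷ z ∷ []) , refl , fq
onBoard-true f (x ∷ y ∷ -[1+ _ ] ∷ []) ()
onBoard-true f (-[1+ _ ] ∷ y ∷ + z ∷ []) ()
onBoard-true f (+ x ∷ -[1+ _ ] ∷ + z ∷ []) ()

-- Boolean recursion for outcomes

does-true : ∀ {A : Set} (A? : Dec A) → T (does A?) → A
does-true (yes a) _ = a

isP : LatticeGame → ℕ³ → Bool
isP G p = does (IsP? G p)

isP-recursive : ∀ G → NormalPlay G → ∀ p →
  isP G p ≡ not (any (λ γ → onBoard (isP G) (ι p -³ γ)) (LatticeGame.ruleset G))
isP-recursive G normal p with any winning (LatticeGame.ruleset G) in eq
  where
  winning : ℤ³ → Bool
  winning γ = onBoard (isP G) (ι p -³ γ)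
... | true = dec-false (IsP? G p) λ isPp →
  let γ , γ∈Γ , win = find (any⁻ _ _ (Equivalence.from T-≡ eq))
      q , q≡ , isPq = onBoard-true (isP G) (ι p -³ γ) win
  in proj₂ (Equivalence.to (IsP-unfold G p) isPp) q
       (normal q , γ , γ∈Γ , q≡) (does-true (IsP? G q) isPq)
... | false = dec-true (IsP? G p) (Equivalence.from (IsP-unfold G p)
  (normal p , λ q (_ , γ , γ∈Γ , q≡) isPq →
    subst T eq (any⁺ _ (lose γ∈Γ (subst (λ v → T (onBoard (isP G) v)) q≡
      (subst T (sym (trans (onBoard-ι (isP G) q) (dec-true (IsP? G q) isPq))) _))))))

module _ {A : Set} {f : A → Bool} where

  any-true : ∀ {xs} → Any (λ x → f x ≡ true) xs → any f xs ≡ true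
  any-true (here fx) rewrite fx = refl
  any-true {x ∷ _} (there fxs) = trans (cong (f x ∨_) (any-true fxs)) (∨-zeroʳ (f x))

  any-false : ∀ {xs} → All (λ x → f x ≡ false) xs → any f xs ≡ false
  any-false []         = refl
  any-false (fx ∷ fxs) = cong₂ _∨_ fx (any-false fxs)

  any-++ : ∀ xs {ys} → any f (xs ++ ys) ≡ any f xs ∨ any f ys
  any-++ []       = refl
  any-++ (x ∷ xs) = trans (cong (f x ∨_) (any-++ xs)) (sym (∨-assoc (f x) _ _))

  any-cong : ∀ {g} → (∀ x → f x ≡ g x) → ∀ xs → any f xs ≡ any g xs
  any-cong f≡g []       = refl
  any-cong f≡g (x ∷ xs) = cong₂ _∨_ (f≡g x) (any-cong f≡g xs)

  any-filter : ∀ {P : A → Set} (P? : ∀ x → Dec (P x)) → (∀ x → ¬ P x → f x ≡ false) →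
               ∀ xs → any f xs ≡ any f (filter P? xs)
  any-filter P? ¬P⇒false []       = refl
  any-filter P? ¬P⇒false (x ∷ xs) with P? x
  ... | yes _  = cong (f x ∨_) (any-filter P? ¬P⇒false xs)
  ... | no ¬Px = cong₂ _∨_ (¬P⇒false x ¬Px) (any-filter P? ¬P⇒false xs)

-- The moves lowering z by 0 and by 1.  In the layer z = 1 the first seven flat moves
-- are the wires of the circuit; the other three only shape the layer z = 0.
flat down : List (ℤ × ℤ)
flat = (+ 3 , - + 2) ∷ (- + 1 , + 3) ∷ (- + 1 , + 2) ∷ (+ 2 , + 0) ∷ (+ 1 , + 1)
     ∷ (+ 0 , + 4) ∷ (+ 0 , + 1) ∷ (+ 1 , + 0) ∷ (+ 2 , + 2) ∷ (+ 2 , + 3) ∷ []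
down = (- + 2 , - + 2) ∷ (- + 1 , - + 3) ∷ (- + 1 , - + 4)
     ∷ (+ 0 , - + 2) ∷ (+ 0 , - + 1) ∷ (- + 3 , - + 1) ∷ []

lower : ℕ → ℤ × ℤ → ℤ³
lower c (a , b) = a ∷ b ∷ + c ∷ []

rules : List ℤ³
rules = map (lower 0) flat ++ map (lower 1) down

-- Flat moves have positive coordinate sum, and the (x , y)-parts of `down` have sum at least -5,
-- which 10 outweighs.
weight : LinearFunctional
weight = 1ℚ ∷ 1ℚ ∷ + 10 ℚ./ 1 ∷ []

game : LatticeGame
game = record
  { defeated     = []
  ; ruleset      = rules
  ; board-closed = λ _ _ _ ()
  ; pointed      = weight
                 , (λ γ → All.lookup (from-yes (All.all? (λ γ → 0ℚ ℚ.<? weight ⟨ γ ⟩) rules)))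
                 , from-yes (Fin.all? λ i → 0ℚ ℚ.<? weight ⟨ ι (e i) ⟩)
  ; tangent-cone = λ i → find (from-yes (Fin.all? λ i → Any.any? (λ γ →
      Fin.all? λ j → ¬? (j Fin.≟ i) →-dec (lookup γ j ℤ.≤? 0ℤ)) rules) i)
  }

normal : NormalPlay game
normal p ()

-- Subtraction and residues

-- x ⊟ a is + x - a, by cases chosen so that x ⊟ a computes at x = r + i * 4.
infixl 6 _⊟_

_⊟_ : ℕ → ℤ → ℤ
x ⊟ + zero    = + x
x ⊟ + suc n   = x ⊖ suc n
x ⊟ -[1+ n ] = + (suc n + x)

⊟≡- : ∀ x a → + x ℤ.- a ≡ x ⊟ a
⊟≡- x (+ zero)  = cong +_ (+-identityʳ x)
⊟≡- x (+ suc n) = refl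
⊟≡- x -[1+ n ]  = cong +_ (+-comm x (suc n))

⊟-nonneg : ∀ {x a} → a ℤ.≤ + x → ∃[ q ] x ⊟ a ≡ + q
⊟-nonneg {x} {+ zero}   _            = x , refl
⊟-nonneg {x} {+ suc n}  (ℤ.+≤+ n<x)  = _ , ℤ.⊖-≥ n<x
⊟-nonneg {x} { -[1+ n ]} _            = _ , refl

residue : (n : ℕ) .{{_ : NonZero n}} → ℤ → ℕ → ℕ
residue n a r = (r + (- a) %ℕ n) % n

%-⊟ : ∀ n .{{_ : NonZero n}} x a {q} → x ⊟ a ≡ + q → q % n ≡ residue n a (x % n)
%-⊟ n x a {q} eq = trans (lemma k q≡) (%-shift x)
  where
  m = (- a) %ℕ n
  k = (- a) /ℕ n

  q≡ : + q ≡ + (x + m) ℤ.+ k ℤ.* + n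
  q≡ = trans (sym eq) (trans (sym (⊟≡- x a))
         (trans (cong (λ v → + x ℤ.+ v) (a≡a%ℕn+[a/ℕn]*n (- a) n))
                (sym (ℤ.+-assoc (+ x) (+ m) (k ℤ.* + n)))))

  lemma : ∀ k → + q ≡ + (x + m) ℤ.+ k ℤ.* + n → q % n ≡ (x + m) % n
  lemma (+ k) q≡ = trans (cong (_% n) (ℤ.+-injective
      (trans q≡ (cong (λ v → + (x + m) ℤ.+ v) (sym (ℤ.pos-* k n))))))
    ([m+kn]%n≡m%n (x + m) k n)
  -- For a negative quotient the multiple of `n` is moved to the side of `q`, so that the congruence
  -- is again one in ℕ.
  lemma -[1+ k ] q≡ = trans (sym ([m+kn]%n≡m%n q (suc k) n)) (cong (_% n) (ℤ.+-injective (begin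
    + q ℤ.+ + (suc k * n)
      ≡⟨ cong₂ ℤ._+_ q≡ (ℤ.pos-* (suc k) n) ⟩
    + (x + m) ℤ.+ -[1+ k ] ℤ.* + n ℤ.+ + suc k ℤ.* + n
      ≡⟨ ℤ.+-assoc (+ (x + m)) (-[1+ k ] ℤ.* + n) (+ suc k ℤ.* + n) ⟩
    + (x + m) ℤ.+ (-[1+ k ] ℤ.* + n ℤ.+ + suc k ℤ.* + n)
      ≡⟨ cong (λ v → + (x + m) ℤ.+ v) (ℤ.*-distribʳ-+ (+ n) -[1+ k ] (+ suc k)) ⟨
    + (x + m) ℤ.+ (-[1+ k ] ℤ.+ + suc k) ℤ.* + n
      ≡⟨ cong (λ v → + (x + m) ℤ.+ v ℤ.* + n) (ℤ.+-inverseˡ (+ suc k)) ⟩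
    + (x + m) ℤ.+ 0ℤ
      ≡⟨ ℤ.+-identityʳ _ ⟩
    + (x + m)
      ∎)))
    where open ≡-Reasoning

  %-shift : ∀ x → (x + m) % n ≡ (x % n + m) % n
  %-shift x = begin
    (x + m) % n              ≡⟨ %-distribˡ-+ x m n ⟩
    (x % n + m % n) % n      ≡⟨ cong (λ v → (v + m % n) % n) (m%n%n≡m%n x n) ⟨
    (x % n % n + m % n) % n  ≡⟨ %-distribˡ-+ (x % n) m n ⟨
    (x % n + m) % n          ∎
    where open ≡-Reasoning

onQuadrant : (ℕ → ℕ → Bool) → ℤ → ℤ → Bool
onQuadrant f (+ x)    (+ y)    = f x y
onQuadrant f (+ x)    -[1+ _ ] = false
onQuadrant f -[1+ _ ] y        = false

onQuadrant-false : ∀ f X Y → (∀ x y → X ≡ + x → Y ≡ + y → f x y ≡ false) →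
                   onQuadrant f X Y ≡ false
onQuadrant-false f (+ x)    (+ y)    f≡ = f≡ x y refl refl
onQuadrant-false f (+ x)    -[1+ _ ] f≡ = refl
onQuadrant-false f -[1+ _ ] y        f≡ = refl

onBoard≡onQuadrant : ∀ f z X Y →
  onBoard f (X ∷ Y ∷ + z ∷ []) ≡ onQuadrant (λ x y → f (x ∷ y ∷ z ∷ [])) X Y
onBoard≡onQuadrant f z (+ x)    (+ y)    = refl
onBoard≡onQuadrant f z (+ x)    -[1+ _ ] = refl
onBoard≡onQuadrant f z -[1+ _ ] y        = refl

-- Abstract to keep the well-founded recursion from unfolding.
abstract
  outcome : ℕ³ → Bool
  outcome = isP game

  outcome≡isP : ∀ p → outcome p ≡ isP game p
  outcome≡isP p = refl

  outcome-recursive : ∀ p →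
    outcome p ≡ not (any (λ γ → onBoard outcome (ι p -³ γ)) rules)
  outcome-recursive = isP-recursive game normal

-- The layers z = 0 and z = 1

layer : ℕ → ℕ → ℕ → Bool
layer z x y = outcome (x ∷ y ∷ z ∷ [])

reach : ℕ → ℕ → ℕ → ℤ × ℤ → Bool
reach z x y (a , b) = onQuadrant (layer z) (x ⊟ a) (y ⊟ b)

onBoard≡reach : ∀ z x y a b →
  onBoard outcome ((+ x ℤ.- a) ∷ (+ y ℤ.- b) ∷ + z ∷ []) ≡ reach z x y (a , b)
onBoard≡reach z x y a b = trans (onBoard≡onQuadrant outcome z (+ x ℤ.- a) (+ y ℤ.- b))
  (cong₂ (onQuadrant (layer z)) (⊟≡- x a) (⊟≡- y b))

any-rules : ∀ f → any f rules ≡ any (f ∘ lower 0) flat ∨ any (f ∘ lower 1) down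
any-rules f = any-++ {f = f} (map (lower 0) flat) {map (lower 1) down}

layer₀-recursive : ∀ x y → layer 0 x y ≡ not (any (reach 0 x y) flat)
layer₀-recursive x y = trans (outcome-recursive (x ∷ y ∷ 0 ∷ [])) (cong not
  -- From z = 0 all options under `down` compute to `false`.
  (trans (any-rules options) (trans (∨-identityʳ (any (options ∘ lower 0) flat))
    (any-cong (λ (a , b) → onBoard≡reach 0 x y a b) flat))))
  where
  options : ℤ³ → Bool
  options γ = onBoard outcome (ι (x ∷ y ∷ 0 ∷ []) -³ γ)

layer₁-recursive : ∀ x y →
  layer 1 x y ≡ not (any (reach 1 x y) flat ∨ any (reach 0 x y) down)
layer₁-recursive x y = trans (outcome-recursive (x ∷ y ∷ 1 ∷ [])) (cong not
  (trans (any-rules options)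
    (cong₂ _∨_ (any-cong (λ (a , b) → onBoard≡reach 1 x y a b) flat)
               (any-cong (λ (a , b) → onBoard≡reach 0 x y a b) down))))
  where
  options : ℤ³ → Bool
  options γ = onBoard outcome (ι (x ∷ y ∷ 1 ∷ []) -³ γ)

-- Residue classes modulo (4 , 5)

open DecMembership (≡-dec _≟_ _≟_) using (_∈?_)

-- The classes modulo (4 , 5) of the P-positions in the layer z = 0, and those not
-- masked in the layer z = 1: output, inputs, left and below.
cold live : List (ℕ × ℕ)
cold = (0 , 0) ∷ (0 , 2) ∷ (2 , 1) ∷ []
live = (2 , 2) ∷ (1 , 0) ∷ (0 , 2) ∷ (2 , 1) ∷ []

afterMove : ℕ × ℕ → ℤ × ℤ → ℕ × ℕ
afterMove (r , s) (a , b) = residue 4 a r , residue 5 b s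

-- The bounds ensure that the move stays on the board from every point of the class.
Killed Safe : List (ℤ × ℤ) → ℕ × ℕ → Set
Killed moves (r , s) =
  Any (λ (a , b) → a ℤ.≤ + r × b ℤ.≤ + s × afterMove (r , s) (a , b) ∈ cold) moves
Safe moves c = All (λ γ → ¬ afterMove c γ ∈ cold) moves

killed? : ∀ moves c → Dec (Killed moves c)
killed? moves (r , s) = Any.any? (λ (a , b) →
  (a ℤ.≤? + r) ×-dec (b ℤ.≤? + s) ×-dec (afterMove (r , s) (a , b) ∈? cold)) moves

safe? : ∀ moves c → Dec (Safe moves c)
safe? moves c = All.all? (λ γ → ¬? (afterMove c γ ∈? cold)) moves

class : ℕ → ℕ → ℕ × ℕ
class x y = x % 4 , y % 5

∀class? : ∀ {P : ℕ × ℕ → Set} (P? : ∀ c → Dec (P c)) →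
          Dec (∀ {r} → r < 4 → ∀ {s} → s < 5 → P (r , s))
∀class? P? = allUpTo? (λ r → allUpTo? (λ s → P? (r , s)) 5) 4

-- With its converse below, checked on all 20 classes: `cold` is a kernel for the flat moves, that
-- is, no move joins two cold classes and every other class has a move into a cold one.
cold⇒safe : ∀ x y → class x y ∈ cold → Safe flat (class x y)
cold⇒safe x y = from-yes (∀class? λ c → (c ∈? cold) →-dec safe? flat c)
  (m%n<n x 4) (m%n<n y 5)

¬cold⇒killed : ∀ x y → ¬ class x y ∈ cold → Killed flat (class x y)
¬cold⇒killed x y = from-yes (∀class? λ c → ¬? (c ∈? cold) →-dec killed? flat c)
  (m%n<n x 4) (m%n<n y 5)

-- With its converse below: `live` consists of exactly those classes that no `down` move takes to a
-- cold class.
live⇒safe : ∀ x y → class x y ∈ live → Safe down (class x y)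
live⇒safe x y = from-yes (∀class? λ c → (c ∈? live) →-dec safe? down c)
  (m%n<n x 4) (m%n<n y 5)

¬live⇒killed : ∀ x y → ¬ class x y ∈ live → Killed down (class x y)
¬live⇒killed x y = from-yes (∀class? λ c → ¬? (c ∈? live) →-dec killed? down c)
  (m%n<n x 4) (m%n<n y 5)

class-⊟ : ∀ x y a b {x′ y′} → x ⊟ a ≡ + x′ → y ⊟ b ≡ + y′ →
          class x′ y′ ≡ afterMove (class x y) (a , b)
class-⊟ x y a b x≡ y≡ = cong₂ _,_ (%-⊟ 4 x a x≡) (%-⊟ 5 y b y≡)

ColdAt : ℕ → ℕ → Set
ColdAt x y = layer 0 x y ≡ does (class x y ∈? cold)

-- The hypothesis is the induction hypothesis while the layer z = 0 is determined, and `layer₀-cold`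
-- for moves down from z = 1.
module _ {x y moves}
  (reachable-cold : ∀ {a b} → (a , b) ∈ moves → ∀ {x′ y′} → x ⊟ a ≡ + x′ → y ⊟ b ≡ + y′ →
                    ColdAt x′ y′)
  where

  killed⇒reach : Killed moves (class x y) → any (reach 0 x y) moves ≡ true
  killed⇒reach killed with (a , b) , γ∈ , a≤ , b≤ , isCold ← find killed
    with x′ , x≡ ← ⊟-nonneg (ℤ.≤-trans a≤ (ℤ.+≤+ (m%n≤m x 4)))
       | y′ , y≡ ← ⊟-nonneg (ℤ.≤-trans b≤ (ℤ.+≤+ (m%n≤m y 5))) =
    any-true (lose γ∈ (trans (cong₂ (onQuadrant (layer 0)) x≡ y≡)
      (trans (reachable-cold γ∈ x≡ y≡)
        (dec-true (_ ∈? cold) (subst (_∈ cold) (sym (class-⊟ x y a b x≡ y≡)) isCold)))))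

  safe⇒¬reach : Safe moves (class x y) → any (reach 0 x y) moves ≡ false
  safe⇒¬reach safe = any-false {xs = moves} (All.tabulate λ { {a , b} γ∈ →
    onQuadrant-false (layer 0) _ _ λ x′ y′ x≡ y≡ → trans (reachable-cold γ∈ x≡ y≡)
      (dec-false (_ ∈? cold) λ isCold →
        All.lookup safe γ∈ (subst (_∈ cold) (class-⊟ x y a b x≡ y≡) isCold)) })

-- The induction runs along options, because flat moves can raise x or y.
layer₀-cold : ∀ x y → ColdAt x y
layer₀-cold x y = go x y (◁-wellFounded game _)
  where
  open LatticeGame game using (_◁_)

  go : ∀ x y → Acc _◁_ (x ∷ y ∷ 0 ∷ []) → ColdAt x y
  go x y (acc rs) = trans (layer₀-recursive x y) (by-class (class x y ∈? cold))
    where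
    reachable-cold : ∀ {a b} → (a , b) ∈ flat → ∀ {x′ y′} →
                     x ⊟ a ≡ + x′ → y ⊟ b ≡ + y′ → ColdAt x′ y′
    reachable-cold {a} {b} γ∈ {x′} {y′} x≡ y≡ = go x′ y′ (rs ((λ ()) , lower 0 (a , b) ,
      ∈-++⁺ˡ (∈-map⁺ (lower 0) γ∈) ,
      sym (cong₂ (λ u v → u ∷ v ∷ + 0 ∷ []) (trans (⊟≡- x a) x≡) (trans (⊟≡- y b) y≡))))

    by-class : (cold? : Dec (class x y ∈ cold)) →
               not (any (reach 0 x y) flat) ≡ does cold?
    by-class (yes isCold) = cong not (safe⇒¬reach reachable-cold (cold⇒safe x y isCold))
    by-class (no ¬cold)   = cong not (killed⇒reach reachable-cold (¬cold⇒killed x y ¬cold))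

layer₁-masked : ∀ x y → ¬ class x y ∈ live → layer 1 x y ≡ false
layer₁-masked x y ¬live = trans (layer₁-recursive x y) (cong not
  (trans (cong (any (reach 1 x y) flat ∨_)
           (killed⇒reach (λ _ {x′} {y′} _ _ → layer₀-cold x′ y′) (¬live⇒killed x y ¬live)))
         (∨-zeroʳ _)))

wires : ℕ × ℕ → List (ℤ × ℤ)
wires c = filter (λ γ → afterMove c γ ∈? live) flat

-- No `down` move reaches a P-position, and flat moves into masked classes reach N-positions; what
-- remains are the wires.
layer₁-live : ∀ x y → class x y ∈ live →
              layer 1 x y ≡ not (any (reach 1 x y) (wires (class x y)))
layer₁-live x y isLive = begin
  layer 1 x y
    ≡⟨ layer₁-recursive x y ⟩
  not (any (reach 1 x y) flat ∨ any (reach 0 x y) down)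
    ≡⟨ cong (λ v → not (any (reach 1 x y) flat ∨ v))
         (safe⇒¬reach (λ _ {x′} {y′} _ _ → layer₀-cold x′ y′) (live⇒safe x y isLive)) ⟩
  not (any (reach 1 x y) flat ∨ false)
    ≡⟨ cong not (∨-identityʳ _) ⟩
  not (any (reach 1 x y) flat)
    ≡⟨ cong not (any-filter (λ γ → afterMove (class x y) γ ∈? live) masked flat) ⟩
  not (any (reach 1 x y) (wires (class x y)))
    ∎
  where
  open ≡-Reasoning
  masked : ∀ γ → ¬ afterMove (class x y) γ ∈ live → reach 1 x y γ ≡ false
  masked (a , b) ¬live = onQuadrant-false (layer 1) _ _ λ x′ y′ x≡ y≡ →
    layer₁-masked x′ y′ (subst (λ c → ¬ c ∈ live) (sym (class-⊟ x y a b x≡ y≡)) ¬live)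

-- For numerals `r` and `s`, `wires c` evaluates to two moves whose targets also compute, so the
-- inputs of the NOR gate are read off by evaluation.
gate : ∀ r s {c} → c ≡ (r % 4 , s % 5) → c ∈ live → ∀ i j →
       layer 1 (r + i * 4) (s + j * 5) ≡
       not (any (reach 1 (r + i * 4) (s + j * 5)) (wires c))
gate r s refl isLive i j =
  subst (λ c → layer 1 x y ≡ not (any (reach 1 x y) (wires c))) class≡
    (layer₁-live x y (subst (_∈ live) (sym class≡) isLive))
  where
  x = r + i * 4
  y = s + j * 5
  class≡ : class x y ≡ (r % 4 , s % 5)
  class≡ = cong₂ _,_ ([m+kn]%n≡m%n r i 4) ([m+kn]%n≡m%n s j 5)

-- Layer 1 computes binomial coefficients

-- `u` and `v` stand for the negated outputs of the left and the lower neighbouring block.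
gateValue : ∀ {c} → c ∈ live → Bool → Bool → Bool
gateValue (here _)                         u v = not (u xor v)
gateValue (there (here _))                 u v = u ∧ v
gateValue (there (there (here _)))         u v = u ∧ not v
gateValue (there (there (there (here _)))) u v = v ∧ not u

nor-inputs : ∀ u v → not (not u ∨ not v ∨ false) ≡ u ∧ v
nor-inputs false v     = refl
nor-inputs true  false = refl
nor-inputs true  true  = refl

nor-left : ∀ u v → not ((u ∧ v) ∨ not u ∨ false) ≡ u ∧ not v
nor-left false v     = refl
nor-left true  false = refl
nor-left true  true  = refl

nor-below : ∀ u v → not ((u ∧ v) ∨ not v ∨ false) ≡ v ∧ not u
nor-below false false = refl
nor-below false true  = refl
nor-below true  false = refl
nor-below true  true  = refl

nor-output : ∀ u v → not ((u ∧ not v) ∨ (v ∧ not u) ∨ false) ≡ not (u xor v)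
nor-output false false = refl
nor-output false true  = refl
nor-output true  false = refl
nor-output true  true  = refl

nor : Bool → Bool → Bool
nor a b = not (a ∨ b ∨ false)

-- Mutual induction over 4 by 5 blocks: within a block, signals run from inputs through left and
-- below to output, and block (i , j) reads the outputs of (i - 1 , j) and (i , j - 1). Outputs
-- carry negated parities, on which XNOR acts as Pascal's rule.
layer₁-output : ∀ i j → layer 1 (2 + i * 4) (2 + j * 5) ≡ not (pascal (suc i) (suc j))
layer₁-inputs : ∀ i j → layer 1 (1 + i * 4) (j * 5) ≡ pascal i (suc j) ∧ pascal (suc i) j
layer₁-left   : ∀ i j → layer 1 (i * 4) (2 + j * 5) ≡ pascal i (suc j) ∧ not (pascal (suc i) j)
layer₁-below  : ∀ i j → layer 1 (2 + i * 4) (1 + j * 5) ≡ pascal (suc i) j ∧ not (pascal i (suc j))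

layer₁-output i j = trans (gate 2 2 refl (here refl) i j)
  (trans (cong₂ nor (layer₁-left i j) (layer₁-below i j))
         (nor-output (pascal i (suc j)) (pascal (suc i) j)))

layer₁-inputs i j = trans (gate 1 0 refl (there (here refl)) i j)
  (trans (cong₂ nor (left i) (below j)) (nor-inputs (pascal i (suc j)) (pascal (suc i) j)))
  where
  left : ∀ i → onQuadrant (layer 1) ((1 + i * 4) ⊟ + 3) (+ (2 + j * 5)) ≡ not (pascal i (suc j))
  -- A wire leaving the board reads `false`, the negation of the border value of Pascal's triangle.
  left zero    = refl
  left (suc i) = layer₁-output i j

  below : ∀ j → onQuadrant (layer 1) (+ (2 + i * 4)) (j * 5 ⊟ + 3) ≡ not (pascal (suc i) j)
  below zero    = refl
  below (suc j) = layer₁-output i j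

layer₁-left i j = trans (gate 0 2 refl (there (there (here refl))) i j)
  (trans (cong₂ nor (layer₁-inputs i j) (left i)) (nor-left (pascal i (suc j)) (pascal (suc i) j)))
  where
  left : ∀ i → onQuadrant (layer 1) (i * 4 ⊟ + 2) (+ (2 + j * 5)) ≡ not (pascal i (suc j))
  left zero    = refl
  left (suc i) = layer₁-output i j

layer₁-below i j = trans (gate 2 1 refl (there (there (there (here refl)))) i j)
  (trans (cong₂ nor (layer₁-inputs i j) (below j)) (nor-below (pascal i (suc j)) (pascal (suc i) j)))
  where
  below : ∀ j → onQuadrant (layer 1) (+ (2 + i * 4)) ((1 + j * 5) ⊟ + 4) ≡ not (pascal (suc i) j)
  below zero    = refl
  below (suc j) = layer₁-output i j

layer₁-gateValue : ∀ {r s} (isLive : (r , s) ∈ live) i j →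
  layer 1 (r + i * 4) (s + j * 5) ≡ gateValue isLive (pascal i (suc j)) (pascal (suc i) j)
layer₁-gateValue (here refl)                         = layer₁-output
layer₁-gateValue (there (here refl))                 = layer₁-inputs
layer₁-gateValue (there (there (here refl)))         = layer₁-left
layer₁-gateValue (there (there (there (here refl)))) = layer₁-below

-- Shifting the layers in the y-direction

class-shift : ∀ x y k → class x (y + k * 5) ≡ class x y
class-shift x y k = cong (x % 4 ,_) ([m+kn]%n≡m%n y k 5)

layer₀-periodic : ∀ x y k → layer 0 x (y + k * 5) ≡ layer 0 x y
layer₀-periodic x y k = trans (layer₀-cold x (y + k * 5))
  (trans (cong (λ c → does (c ∈? cold)) (class-shift x y k)) (sym (layer₀-cold x y)))

live-0 : ∀ {r s} → (r , s) ∈ live → r ≡ 0 → s ≡ 2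
live-0 (there (there (here refl))) refl = refl
live-0 (here refl)                         ()
live-0 (there (here refl))                 ()
live-0 (there (there (there (here refl)))) ()

module _ {t} (self : SelfSimilar (suc t)) where
  open SelfSimilar self

  +5-shift : ∀ s j → s + j * 5 + suc t * 5 ≡ s + (suc t + j) * 5
  +5-shift s j = trans (+-assoc s (j * 5) (suc t * 5))
    (cong (λ v → s + v) (trans (+-comm (j * 5) (suc t * 5)) (sym (*-distribʳ-+ 5 (suc t) j))))

  -- A block involves `pascal i` and `pascal (suc i)`, and both have the period when `i < t`.
  layer₁-live-periodic : ∀ {r s i} → (r , s) ∈ live → i < t → ∀ j →
    layer 1 (r + i * 4) (s + j * 5 + suc t * 5) ≡ layer 1 (r + i * 4) (s + j * 5)
  layer₁-live-periodic {r} {s} {i} isLive i<t j = begin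
    layer 1 (r + i * 4) (s + j * 5 + suc t * 5)
      ≡⟨ cong (layer 1 (r + i * 4)) (+5-shift s j) ⟩
    layer 1 (r + i * 4) (s + (suc t + j) * 5)
      ≡⟨ layer₁-gateValue isLive i (suc t + j) ⟩
    gateValue isLive (pascal i (suc (suc t + j))) (pascal (suc i) (suc t + j))
      ≡⟨ cong₂ (gateValue isLive)
           (trans (cong (pascal i) (sym (+-suc (suc t) j))) (periodic (m<n⇒m<1+n i<t) (suc j)))
           (periodic (s<s i<t) j) ⟩
    gateValue isLive (pascal i (suc j)) (pascal (suc i) j)
      ≡⟨ layer₁-gateValue isLive i j ⟨
    layer 1 (r + i * 4) (s + j * 5)
      ∎
    where open ≡-Reasoning

  layer₁-masked-periodic : ∀ x y → ¬ class x y ∈ live → layer 1 x (y + suc t * 5) ≡ layer 1 x y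
  layer₁-masked-periodic x y ¬live = trans
    (layer₁-masked x (y + suc t * 5) (subst (λ c → ¬ c ∈ live) (sym (class-shift x y (suc t))) ¬live))
    (sym (layer₁-masked x y ¬live))

  layer₁-periodic : ∀ x y → x < t * 4 → layer 1 x (y + suc t * 5) ≡ layer 1 x y
  layer₁-periodic x y x< with class x y ∈? live
  ... | no ¬live   = layer₁-masked-periodic x y ¬live
  ... | yes isLive = subst₂ (λ x y → layer 1 x (y + suc t * 5) ≡ layer 1 x y)
    (sym (m≡m%n+[m/n]*n x 4)) (sym (m≡m%n+[m/n]*n y 5))
    (layer₁-live-periodic isLive (m<n*o⇒m/o<n x<) (y / 5))

  column-before : ∀ j → j < t → layer 1 (t * 4) (2 + j * 5) ≡ false
  column-before j j<t = trans (layer₁-left t j)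
    (cong (_∧ not (pascal (suc t) j)) (pascal-before-edge self j<t))

  column-after : ∀ j → j < t → layer 1 (t * 4) (2 + (suc t + j) * 5) ≡ false
  column-after j j<t = trans (layer₁-left t (suc t + j))
    (cong (_∧ not (pascal (suc t) (suc t + j)))
      (trans (cong (pascal t) (sym (+-suc (suc t) j)))
        (trans (periodic (n<1+n t) (suc j)) (pascal-before-edge self j<t))))

  -- For x = 4t the only live class is that of the left gates, whose factor `pascal t (suc j)` is
  -- false for `j < t`, before and after the shift.
  layer₁-column : ∀ y → y < 2 + t * 5 → layer 1 (t * 4) (y + suc t * 5) ≡ layer 1 (t * 4) y
  layer₁-column y y< with class (t * 4) y ∈? live
  ... | no ¬live   = layer₁-masked-periodic (t * 4) y ¬live
  ... | yes isLive = subst (λ y → layer 1 (t * 4) (y + suc t * 5) ≡ layer 1 (t * 4) y) (sym y≡)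
    (trans (trans (cong (layer 1 (t * 4)) (+5-shift 2 (y / 5))) (column-after (y / 5) y/5<t))
           (sym (column-before (y / 5) y/5<t)))
    where
    y≡ : y ≡ 2 + y / 5 * 5
    y≡ = trans (m≡m%n+[m/n]*n y 5) (cong (_+ y / 5 * 5) (live-0 isLive (m*n%n≡0 t 4)))

    y/5<t : y / 5 < t
    y/5<t = *-cancelʳ-< 5 (y / 5) t (+-cancelˡ-< 2 (y / 5 * 5) (t * 5) (subst (_< 2 + t * 5) y≡ y<))

  -- At the left gate of block (t , t) the factor `pascal t _` is true both before and after the
  -- shift, while the entry of `pascal (suc t)` flips from `edge-ones` to `edge-zero`.
  corner-before : layer 1 (t * 4) (2 + t * 5) ≡ false
  corner-before = trans (layer₁-left t t) (trans
    (cong (λ v → pascal t (suc t) ∧ not v) (edge-ones self (n<1+n t))) (∧-zeroʳ _))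

  corner-after : layer 1 (t * 4) (2 + t * 5 + suc t * 5) ≡ true
  corner-after = begin
    layer 1 (t * 4) (2 + t * 5 + suc t * 5)
      ≡⟨ cong (layer 1 (t * 4)) (+5-shift 2 t) ⟩
    layer 1 (t * 4) (2 + (suc t + t) * 5)
      ≡⟨ layer₁-left t (suc t + t) ⟩
    pascal t (suc (suc t + t)) ∧ not (pascal (suc t) (suc t + t))
      ≡⟨ cong₂ (λ u v → u ∧ not v)
           (trans (cong (pascal t) (sym (+-suc (suc t) t))) (pascal-corner self)) (edge-zero self) ⟩
    true
      ∎
    where open ≡-Reasoning

  breaksAt : BreaksAt (generatingFunction game) (suc t * 5) (t * 4 ∷ 2 + t * 5 ∷ 1 ∷ [])
  breaksAt = record
    { before = λ where
        -- The points before `s` are the layer z = 0, the columns with x < 4t, and the part of the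
        -- column of `s` below it.
        (x ∷ y ∷ z ∷ []) (inj₁ z<s)                      → series-≡ x y 0 (layer₀-periodic x y (suc t))
        (x ∷ y ∷ z ∷ []) (inj₂ (refl , inj₁ x<))         → series-≡ x y 1 (layer₁-periodic x y x<)
        (x ∷ y ∷ z ∷ []) (inj₂ (refl , inj₂ (refl , y<))) → series-≡ x y 1 (layer₁-column y y<)
    ; at = λ eq → contradiction
        (trans (sym (series-value (t * 4) (2 + t * 5 + suc t * 5) 1 corner-after))
          (trans eq (series-value (t * 4) (2 + t * 5) 1 corner-before)))
        λ ()
    }
    where
    series-value : ∀ x y z {b} → layer z x y ≡ b →
                   generatingFunction game (x ∷ y ∷ z ∷ []) ≡ (if b then 1ℤ else 0ℤ)
    series-value x y z eq = cong (if_then 1ℤ else 0ℤ) (trans (sym (outcome≡isP (x ∷ y ∷ z ∷ []))) eq)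

    series-≡ : ∀ x y z → layer z x (y + suc t * 5) ≡ layer z x y →
               shift₂ (suc t * 5) (generatingFunction game) (x ∷ y ∷ z ∷ []) ≡
               generatingFunction game (x ∷ y ∷ z ∷ [])
    series-≡ x y z eq = trans (series-value x (y + suc t * 5) z eq) (sym (series-value x y z refl))

theorem1p1 : Σ[ G ∈ LatticeGame ] NormalPlay G × ¬ HasRationalStrategy G
theorem1p1 = game , normal , ¬rational λ N →
  let t , N≤t , self = selfSimilar-unbounded N in
  -- The left gate of block (t , t), and a shift by `suc t` blocks of height 5.
  t * 4 , 2 + t * 5 , 1 , suc t * 5 ,
  ≤-trans N≤t (≤-trans (m≤m*n t 5) (m≤n+m (t * 5) 2)) ,
  breaksAt self
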